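{- Let $G$ be a circle graph with clique number $\omega$. Then the chromatic number of $G$ is at most $7\omega^2$.
   Context: An interval system is a finite set $\mathcal{I}$ of open intervals $(a,b)$, $a<b$, contained in $(0,1)$, such that no two distinct intervals share an end and no interval has $0$ or $1$ as an end. Two intervals overlap if they intersect and neither is contained in the other. The overlap graph $G(\mathcal{I})$ is the graph with vertex set $\mathcal{I}$ in which two vertices are adjacent if and only if they overlap as intervals. A graph is a circle graph if it is isomorphic to the overlap graph of an interval system (equivalently, it is the intersection graph of a finite set of chords of a circle). -}

module Defs where

open import Data.Fin.Base using (Fin)
open import Data.Fin.Subset using (Subset; ∣_∣) renaming (_∈_ to _∈ˢ_)
open import Data.Nat.Base as ℕ using (ℕ)
open import Data.Product using (Σ; ∃; ∃-syntax; _×_; _,_)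
open import Data.Rational using (ℚ; 0ℚ; 1ℚ; _<_; _+_; -_)
open import Data.Rational.Properties
  using (<-dense; <-trans; <-asym; <-cmp; +-monoʳ-<; +-identityʳ; positive⁻¹; neg-antimono-<)
open import Data.Sum using (_⊎_; inj₁; inj₂)
open import Function.Base using (id)
open import Function.Bundles using (_⇔_; mk⇔; _↔_; Inverse)
open import Level using (Level; 0ℓ; suc; _⊔_)
open import Relation.Binary.Core using (Rel)
open import Relation.Binary.Definitions using (Symmetric; Irreflexive; tri<; tri≈; tri>)
open import Relation.Binary.PropositionalEquality using (_≡_; _≢_; refl; subst)
open import Relation.Nullary.Negation using (¬_)
open import Relation.Unary using (Pred; _⊆_; _≬_)

private
  variable
    ℓ ℓ′ : Level

-- Two-sided located Dedekind cuts of ℚ.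
record ℝ : Set₁ where
  field
    Lower Upper     : Pred ℚ 0ℓ
    lower-inhabited : ∃[ q ] Lower q
    upper-inhabited : ∃[ q ] Upper q
    lower-rounded   : ∀ q → Lower q ⇔ (∃[ r ] q < r × Lower r)
    upper-rounded   : ∀ q → Upper q ⇔ (∃[ r ] r < q × Upper r)
    disjoint        : ∀ q → ¬ (Lower q × Upper q)
    located         : ∀ {q r} → q < r → Lower q ⊎ Upper r

open ℝ public

infix 4 _<ᴿ_ _≤ᴿ_ _≈ᴿ_ _≉ᴿ_

_<ᴿ_ : ℝ → ℝ → Set
x <ᴿ y = ∃[ q ] Upper x q × Lower y q

_≤ᴿ_ : ℝ → ℝ → Set
x ≤ᴿ y = ¬ (y <ᴿ x)

-- Two reals are equal when neither is below the other; propositional equality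
-- of the records would be too fine.
_≈ᴿ_ : ℝ → ℝ → Set
x ≈ᴿ y = x ≤ᴿ y × y ≤ᴿ x

_≉ᴿ_ : ℝ → ℝ → Set
x ≉ᴿ y = ¬ (x ≈ᴿ y)

fromℚ : ℚ → ℝ
fromℚ p = record
  { Lower           = _< p
  ; Upper           = p <_
  ; lower-inhabited = p + - 1ℚ ,
      subst (p + - 1ℚ <_) (+-identityʳ p) (+-monoʳ-< p (neg-antimono-< 0<1))
  ; upper-inhabited = p + 1ℚ ,
      subst (_< p + 1ℚ) (+-identityʳ p) (+-monoʳ-< p 0<1)
  ; lower-rounded   = λ q → mk⇔ <-dense (λ (_ , q<r , r<p) → <-trans q<r r<p)
  ; upper-rounded   = λ q → mk⇔
      (λ p<q → let (r , p<r , r<q) = <-dense p<q in r , r<q , p<r)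
      (λ (_ , r<q , p<r) → <-trans p<r r<q)
  ; disjoint        = λ q (q<p , p<q) → <-asym q<p p<q
  ; located         = loc
  }
  where
  0<1 : 0ℚ < 1ℚ
  0<1 = positive⁻¹ 1ℚ

  loc : ∀ {q r} → q < r → q < p ⊎ p < r
  loc {q} q<r with <-cmp q p
  ... | tri< q<p _ _    = inj₁ q<p
  ... | tri≈ _ refl _   = inj₂ q<r
  ... | tri> _ _ p<q    = inj₂ (<-trans p<q q<r)

0ᴿ 1ᴿ : ℝ
0ᴿ = fromℚ 0ℚ
1ᴿ = fromℚ 1ℚ

record Interval : Set₁ where
  field
    left right : ℝ
    left<right : left <ᴿ right

open Interval public

⟦_⟧ : Interval → Pred ℝ 0ℓ
⟦ I ⟧ x = left I <ᴿ x × x <ᴿ right I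

unitInterval : Interval
unitInterval = record { left = 0ᴿ ; right = 1ᴿ ; left<right = <-dense (positive⁻¹ 1ℚ) }

data IsEnd (I : Interval) : ℝ → Set₁ where
  isLeft  : ∀ {x} → x ≈ᴿ left I  → IsEnd I x
  isRight : ∀ {x} → x ≈ᴿ right I → IsEnd I x

-- The finite set of intervals is enumerated by Fin size.  The enumeration is
-- without repetition, since distinct indices have no common end.
record IntervalSystem : Set₁ where
  field
    size           : ℕ
    interval       : Fin size → Interval
    contained      : ∀ i → ⟦ interval i ⟧ ⊆ ⟦ unitInterval ⟧
    no-shared-ends : ∀ {i j} → i ≢ j → ∀ x → ¬ (IsEnd (interval i) x × IsEnd (interval j) x)
    0-not-end      : ∀ i → ¬ IsEnd (interval i) 0ᴿ
    1-not-end      : ∀ i → ¬ IsEnd (interval i) 1ᴿ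

Overlap : Rel Interval (suc 0ℓ)
Overlap I J = ⟦ I ⟧ ≬ ⟦ J ⟧ × ¬ (⟦ I ⟧ ⊆ ⟦ J ⟧) × ¬ (⟦ J ⟧ ⊆ ⟦ I ⟧)

-- Simple graphs on a finite vertex set, enumerated as Fin order.  The relation's
-- level is a parameter because Overlap, which quantifies over ℝ, lives in Set₁.
record Graph (ℓ : Level) : Set (suc ℓ) where
  field
    order : ℕ
  Vertex : Set
  Vertex = Fin order
  field
    Adj        : Rel Vertex ℓ
    adj-sym    : Symmetric Adj
    adj-irrefl : Irreflexive _≡_ Adj

open Graph public

record _≅_ (G : Graph ℓ) (H : Graph ℓ′) : Set (ℓ ⊔ ℓ′) where
  field
    bijection : Vertex G ↔ Vertex H
  open Inverse bijection public using (to; from)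
  field
    preserves : ∀ u v → Adj G u v ⇔ Adj H (to u) (to v)

overlapGraph : IntervalSystem → Graph (suc 0ℓ)
overlapGraph 𝓘 = record
  { order      = size
  ; Adj        = λ i j → Overlap (interval i) (interval j)
  ; adj-sym    = λ ((x , x∈I , x∈J) , I⊈J , J⊈I) → (x , x∈J , x∈I) , J⊈I , I⊈J
  ; adj-irrefl = λ { refl (_ , I⊈I , _) → I⊈I id }
  }
  where open IntervalSystem 𝓘

IsCircleGraph : Graph ℓ → Set (suc 0ℓ ⊔ ℓ)
IsCircleGraph G = ∃[ 𝓘 ] G ≅ overlapGraph 𝓘

IsClique : (G : Graph ℓ) → Subset (order G) → Set ℓ
IsClique G S = ∀ {u v} → u ∈ˢ S → v ∈ˢ S → u ≢ v → Adj G u v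

IsCliqueNumber : Graph ℓ → ℕ → Set ℓ
IsCliqueNumber G ω =
  (∃[ S ] IsClique G S × ∣ S ∣ ≡ ω) × (∀ S → IsClique G S → ∣ S ∣ ℕ.≤ ω)

IsProperColouring : (G : Graph ℓ) {k : ℕ} → (Vertex G → Fin k) → Set ℓ
IsProperColouring G c = ∀ {u v} → Adj G u v → c u ≢ c v

Colourable : Graph ℓ → ℕ → Set ℓ
Colourable G k = Σ (Vertex G → Fin k) (IsProperColouring G)

IsChromaticNumber : Graph ℓ → ℕ → Set ℓ
IsChromaticNumber G χ = Colourable G χ × (∀ k → Colourable G k → χ ℕ.≤ k)

{-# OPTIONS --safe #-}
module Submission where

-- Cut (0, 1) successively at points called pillars.  An interval is assigned to the
-- oldest pillar it contains, so intervals with a common pillar form a permutation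
-- graph, which has a proper colouring with ω colours; it remains to colour the pillars
-- with 7ω colours so that crossing intervals have equal or differently coloured pillars.
-- An arc [a, b) between neighbouring pillars sees the older pillars p that are assigned
-- to an interval with one end in [a, b).  A new pillar in [a, b) can be coloured
-- greedily as long as the arc sees fewer than 7ω pillars.
--
-- Suppose that [a, b) sees at most 5ω pillars, and cut it greedily from left to right
-- into arcs seeing 3ω of them.  Two intervals with ends e < e′ in [a, b) and pillars
-- p before p′ in the circular order must cross, so the incidences between arcs and seen
-- pillars contain no strictly increasing chain of length ω + 1.  Hence m arcs seeing 3ω
-- pillars each satisfy 2ωm ≤ 5ω·ω, and there are at most 4^ω arcs altogether.  Making
-- these cuts in the order of a binary tree of depth 2ω adds at most 2ω seen pillars, so
-- each new arc again sees at most 3ω + 2ω = 5ω pillars, and fewer than 5ω + 2ω = 7ω are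
-- seen in between.
--
-- The order of the real ends is not decidable, but the conclusion is, so it may be
-- assumed decidable; the ends are then replaced by their ranks.

open import Defs
open import Data.Empty using (⊥-elim)
open import Data.Fin.Base using (Fin; combine; fromℕ<; join; splitAt)
open import Data.Fin.Properties using (any?; ¬∀⟶∃¬; injective⇒≤)
import Data.Fin.Properties as Fin
open import Data.Fin.Subset using (Subset; ∣_∣; ⁅_⁆; _∪_) renaming (⊥ to ∅; _∈_ to _∈ˢ_)
open import Data.Fin.Subset.Properties
  using (p⊂q⇒∣p∣<∣q∣; ∣p∣≤n; ∣⁅x⁆∣≡1; ∉⊥; x∈⁅x⁆; x∈⁅y⁆⇒x≡y; x∈p∪q⁺; x∈p∪q⁻; q⊆p∪q)
open import Data.List.Base as List using (List; []; _∷_; length)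
open import Data.List.Membership.DecPropositional using () renaming (_∈?_ to mem?)
open import Data.List.Membership.Propositional using (_∈_)
open import Data.List.Properties using (length-map)
open import Data.List.Relation.Unary.All as All using (All; []; _∷_)
open import Data.List.Relation.Unary.AllPairs as AllPairs using (AllPairs; []; _∷_)
import Data.List.Relation.Unary.AllPairs.Properties as AllPairs
open import Data.List.Relation.Unary.Any as Any using (here; there)
open import Data.List.Relation.Unary.Any.Properties using (lookup-index)
open import Data.Nat.Base
open import Data.Nat.Properties
open import Data.Nat.Tactic.RingSolver using (solve-∀)
open import Data.Product.Base using (Σ; ∃-syntax; _×_; _,_; proj₁; proj₂)
import Data.Rational.Base as ℚ
import Data.Rational.Properties as ℚ
open import Data.Sum.Base as Sum using (_⊎_; inj₁; inj₂; [_,_]′)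
open import Data.Unit.Base using (⊤; tt)
import Data.Vec.Base as Vec
open import Data.Vec.Properties using (lookup⇒[]=; []=⇒lookup; lookup∘tabulate)
open import Effect.Monad using (RawMonad)
open import Function.Base using (_∘_; const; id; case_of_)
open import Function.Bundles using (Equivalence; Inverse)
open import Level using (Level; 0ℓ)
open import Relation.Binary.Core using (Rel)
open import Relation.Binary.Definitions using (tri<; tri≈; tri>)
open import Relation.Binary.PropositionalEquality
open import Relation.Nullary.Decidable
  using (Dec; yes; no; does; _×-dec_; _⊎-dec_; ¬?; dec-true; decidable-stable; ¬¬-excluded-middle)
open import Relation.Nullary.Negation using (¬_; contradiction; ¬¬-map; ¬¬-Monad)
open import Relation.Unary using (Pred; Decidable)

-- Counting on initial segments of ℕ, and the greedy choice of a colour.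

∑ : ℕ → (ℕ → ℕ) → ℕ
∑ zero    f = 0
∑ (suc n) f = f n + ∑ n f

∑-mono : ∀ n {f g} → (∀ {k} → k < n → f k ≤ g k) → ∑ n f ≤ ∑ n g
∑-mono zero    f≤g = z≤n
∑-mono (suc n) f≤g = +-mono-≤ (f≤g ≤-refl) (∑-mono n (f≤g ∘ m≤n⇒m≤1+n))

∑-+ : ∀ n f g → ∑ n (λ k → f k + g k) ≡ ∑ n f + ∑ n g
∑-+ zero    f g = refl
∑-+ (suc n) f g = trans (cong (f n + g n +_) (∑-+ n f g)) (interchange (f n) _ _ _)
  where
  interchange : ∀ a b c d → a + b + (c + d) ≡ a + c + (b + d)
  interchange = solve-∀

∑-*ˡ : ∀ c n f → ∑ n (λ k → c * f k) ≡ c * ∑ n f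
∑-*ˡ c zero    f = sym (*-zeroʳ c)
∑-*ˡ c (suc n) f = trans (cong (c * f n +_) (∑-*ˡ c n f)) (sym (*-distribˡ-+ c (f n) _))

∑-split : ∀ m n f → ∑ (m + n) f ≡ ∑ m (λ k → f (k + n)) + ∑ n f
∑-split zero    n f = refl
∑-split (suc m) n f = trans (cong (f (m + n) +_) (∑-split m n f)) (sym (+-assoc (f (m + n)) _ _))

private
  variable
    A B C : Set

ind : Dec A → ℕ
ind (yes _) = 1
ind (no _)  = 0

ind-mono : (A → B) → (a? : Dec A) (b? : Dec B) → ind a? ≤ ind b?
ind-mono f (yes a) (yes b) = ≤-refl
ind-mono f (yes a) (no ¬b) = contradiction (f a) ¬b
ind-mono f (no ¬a) _       = z≤n

ind-⊎ : (A → B ⊎ C) → (a? : Dec A) (b? : Dec B) (c? : Dec C) → ind a? ≤ ind b? + ind c?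
ind-⊎ f (no ¬a) _       _       = z≤n
ind-⊎ f (yes a) (yes b) _       = s≤s z≤n
ind-⊎ f (yes a) (no ¬b) (yes c) = ≤-refl
ind-⊎ f (yes a) (no ¬b) (no ¬c) = ⊥-elim ([ ¬b , ¬c ]′ (f a))

ind-disjoint : (A → C) → (B → C) → (A → ¬ B) →
  (a? : Dec A) (b? : Dec B) (c? : Dec C) → ind a? + ind b? ≤ ind c?
ind-disjoint f g d (yes a) (yes b) _       = contradiction b (d a)
ind-disjoint f g d (yes a) (no ¬b) c?      = ind-mono f (yes a) c?
ind-disjoint f g d (no ¬a) b?      c?      = ind-mono g b? c?

count : {A : Pred ℕ 0ℓ} → Decidable A → ℕ → ℕ
count A? n = ∑ n (ind ∘ A?)

module _ {A B : Pred ℕ 0ℓ} (A? : Decidable A) (B? : Decidable B) where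

  count-mono : ∀ n → (∀ {k} → A k → B k) → count A? n ≤ count B? n
  count-mono n A⊆B = ∑-mono n λ {k} _ → ind-mono A⊆B (A? k) (B? k)

  count-⊎ : {C : Pred ℕ 0ℓ} (C? : Decidable C) → ∀ n → (∀ {k} → A k → B k ⊎ C k) →
    count A? n ≤ count B? n + count C? n
  count-⊎ C? n f = ≤-trans (∑-mono n λ {k} _ → ind-⊎ f (A? k) (B? k) (C? k))
                           (≤-reflexive (∑-+ n _ _))

module _ {A : Pred ℕ 0ℓ} (A? : Decidable A) where

  count-none : ∀ n → (∀ {k} → k < n → ¬ A k) → count A? n ≡ 0
  count-none zero    ¬A = refl
  count-none (suc n) ¬A with A? n
  ... | yes a = contradiction a (¬A ≤-refl)
  ... | no  _ = count-none n (¬A ∘ m≤n⇒m≤1+n)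

  count-unique : ∀ n → (∀ {j k} → A j → A k → j ≡ k) → count A? n ≤ 1
  count-unique zero    _ = z≤n
  count-unique (suc n) u with A? n
  ... | yes a = ≤-reflexive (cong suc (count-none n λ k<n b → <⇒≢ k<n (u b a)))
  ... | no  _ = count-unique n u

  image : {X : Set} (κ : ℕ → X) → ∀ n →
    ∃[ xs ] length xs ≡ count A? n × (∀ {k} → k < n → A k → κ k ∈ xs)
  image κ zero    = [] , refl , λ ()
  image κ (suc n) with A? n | image κ n
  ... | yes a | xs , len , cov = κ n ∷ xs , cong suc len , λ k<1+n Ak →
        [ (λ k<n → there (cov k<n Ak)) , (λ k≡n → here (cong κ k≡n)) ]′ (m≤n⇒m<n∨m≡n (s≤s⁻¹ k<1+n))
  ... | no ¬a | xs , len , cov = xs , len , λ k<1+n Ak →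
        [ (λ k<n → cov k<n Ak) , (λ { refl → contradiction Ak ¬a }) ]′ (m≤n⇒m<n∨m≡n (s≤s⁻¹ k<1+n))

-- Pigeonhole: otherwise mapping each colour to its position in `xs` would be an injection from
-- `Fin K` into fewer than `K` positions.
unlisted : ∀ {K} (xs : List (Fin K)) → length xs < K → ∃[ c ] ¬ c ∈ xs
unlisted {K} xs len = ¬∀⟶∃¬ K (_∈ xs) (λ c → mem? Fin._≟_ c xs) λ all →
  <⇒≱ len (injective⇒≤ {f = λ c → Any.index (all c)} λ {c} {c′} eq →
    trans (lookup-index (all c)) (trans (cong (List.lookup xs) eq) (sym (lookup-index (all c′)))))

fresh : ∀ {A : Pred ℕ 0ℓ} (A? : Decidable A) n {K} (κ : ℕ → Fin K) → count A? n < K →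
  ∃[ c ] (∀ {k} → k < n → A k → c ≢ κ k)
fresh A? n κ few with image A? κ n
... | xs , len , cov with unlisted xs (subst (_< _) (sym len) few)
... | c , c∉xs = c , λ k<n Ak → λ { refl → c∉xs (cov k<n Ak) }

-- Partitions of an arc into consecutive pieces.

-- m counts the cuts, so there are m + 1 nonempty pieces.
data Pieces (G : ℕ → ℕ → Set) : ℕ → ℕ → ℕ → Set where
  one  : ∀ {a b} → a < b → G a b → Pieces G 0 a b
  snoc : ∀ {m a b c} → Pieces G m a b → b < c → G b c → Pieces G (suc m) a c

pieces-< : ∀ {G m a b} → Pieces G m a b → a < b
pieces-< (one a<b _)     = a<b
pieces-< (snoc ps b<c _) = <-trans (pieces-< ps) b<c

split : ∀ {G} m {m′ a b} → Pieces G (suc (m′ + m)) a b → ∃[ c ] Pieces G m a c × Pieces G m′ c b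
split m {zero}   (snoc ps b<c g) = _ , ps , one b<c g
split m {suc m′} (snoc ps b<c g) with split m ps
... | c , psˡ , psʳ = c , psˡ , snoc psʳ b<c g

-- Here `m` will be the number of full pieces, and the two extra ones are the first and the last.
-- After doubling, integrality reduces the bound to 3 + 5ω ≤ 2·4^ω, which is an equality at ω = 1.
pieces-few : ∀ {m ω} → 1 ≤ ω → 2 * m ≤ 5 * ω → suc (suc m) ≤ 2 ^ (2 * ω)
pieces-few {m} {ω} 1≤ω 2m≤5ω = ≮⇒≥ λ few → <⇒≱ (begin-strict
  1 + 2 * 2 ^ (2 * ω) <⟨ ≤-refl ⟩
  2 + 2 * 2 ^ (2 * ω) ≡⟨ *-suc 2 _ ⟨
  2 * suc (2 ^ (2 * ω)) ≤⟨ *-monoʳ-≤ 2 few ⟩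
  2 * suc (suc m)    ≡⟨ rearrange m ⟩
  4 + 2 * m          ≤⟨ +-monoʳ-≤ 4 2m≤5ω ⟩
  4 + 5 * ω          ∎) (s≤s (subst (λ v → 3 + 5 * v ≤ 2 * 2 ^ (2 * v)) (suc-pred ω {{>-nonZero 1≤ω}}) (growth (pred ω))))
  where
  open ≤-Reasoning
  rearrange : ∀ m → 2 * suc (suc m) ≡ 4 + 2 * m
  rearrange = solve-∀
  growth : ∀ w → 3 + 5 * suc w ≤ 2 * 2 ^ (2 * suc w)
  growth zero    = ≤-refl
  growth (suc w) = begin
    3 + 5 * suc v                                       ≡⟨ cong (3 +_) (*-suc 5 v) ⟩
    8 + 5 * v                                           ≡⟨⟩
    5 + (3 + 5 * v)                                     ≤⟨ +-mono-≤ (≤-trans 5≤ ih) ih ⟩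
    X + X                                               ≤⟨ m≤m+n _ _ ⟩
    X + X + (X + X)                                     ≡⟨ rearrange′ (2 ^ (2 * v)) ⟩
    2 * 2 ^ (2 + 2 * v)                                 ≡⟨ cong (λ z → 2 * 2 ^ z) (*-suc 2 v) ⟨
    2 * 2 ^ (2 * suc v)                                 ∎
    where
    v X : ℕ
    v = suc w
    X = 2 * 2 ^ (2 * v)
    ih : 3 + 5 * v ≤ X
    ih = growth w
    5≤ : 5 ≤ 3 + 5 * v
    5≤ = ≤-trans (m≤m+n 5 3) (+-monoʳ-≤ 3 (*-monoʳ-≤ 5 {1} {v} (s≤s z≤n)))
    rearrange′ : ∀ x → 2 * x + 2 * x + (2 * x + 2 * x) ≡ 2 * (2 * (2 * x))
    rearrange′ = solve-∀

-- Chord diagrams, pillars and the pillars seen from an arc.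

record ChordDiagram (n N : ℕ) : Set where
  field
    l r : Fin n → ℕ
    l<r : ∀ i → l i < r i
    r<N : ∀ i → r i < N

  IsEndpoint : Fin n → ℕ → Set
  IsEndpoint i x = x ≡ l i ⊎ x ≡ r i

  field
    ends-unique : ∀ {i j x} → IsEndpoint i x → IsEndpoint j x → i ≡ j

  infix 4 _⇝_

  _⇝_ : Rel (Fin n) 0ℓ
  i ⇝ j = l i < l j × l j < r i × r i < r j

  Cross : Rel (Fin n) 0ℓ
  Cross i j = i ⇝ j ⊎ j ⇝ i

  -- Position q stands for the cut just before q.
  Contains : ℕ → Fin n → Set
  Contains q i = l i < q × q ≤ r i

  Contains? : ∀ q i → Dec (Contains q i)
  Contains? q i = l i <? q ×-dec q ≤? r i

  Inside : ℕ → ℕ → Fin n → Set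
  Inside a b i = a ≤ l i × r i < b

  EndIn : ℕ → ℕ → Fin n → Set
  EndIn a b i = (a ≤ l i × l i < b) ⊎ (a ≤ r i × r i < b)

  EndIn? : ∀ a b i → Dec (EndIn a b i)
  EndIn? a b i = (a ≤? l i ×-dec l i <? b) ⊎-dec (a ≤? r i ×-dec r i <? b)

  -- The list holds the pillars placed so far, newest first; First P i p says that
  -- p is the oldest pillar of P contained in i.
  data First : List ℕ → Fin n → ℕ → Set where
    old : ∀ {q P i p} → First P i p → First (q ∷ P) i p
    new : ∀ {q P i} → All (λ p → ¬ Contains p i) P → Contains q i → First (q ∷ P) i q

  First? : ∀ P i p → Dec (First P i p)
  First? []      i p = no λ ()
  First? (q ∷ P) i p with First? P i p
  ... | yes f = yes (old f)
  ... | no ¬f with p ≟ q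
  ...   | no p≢q   = no λ { (old f) → ¬f f ; (new _ _) → p≢q refl }
  ...   | yes refl with All.all? (λ p → ¬? (Contains? p i)) P ×-dec Contains? q i
  ...     | yes (avoid , c) = yes (new avoid c)
  ...     | no ¬new         = no λ { (old f) → ¬f f ; (new avoid c) → ¬new (avoid , c) }

  First⇒∈ : ∀ {P i p} → First P i p → p ∈ P
  First⇒∈ (old f)   = there (First⇒∈ f)
  First⇒∈ (new _ _) = here refl

  First⇒Contains : ∀ {P i p} → First P i p → Contains p i
  First⇒Contains (old f)   = First⇒Contains f
  First⇒Contains (new _ c) = c

  First⇒< : ∀ {P i p} → First P i p → p < N
  First⇒< {i = i} f = ≤-<-trans (proj₂ (First⇒Contains f)) (r<N i)

  -- If the pillars differed, the older one would lie in both intervals, so the interval assigned to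
  -- the newer one would have been assigned to the older one instead.
  First-agree : ∀ {P i j p p′} → First P i p → First P j p′ → Contains p j → Contains p′ i → p ≡ p′
  First-agree (old f)       (old f′)       c c′ = First-agree f f′ c c′
  First-agree (old f)       (new avoid _)  c c′ = contradiction c (All.lookup avoid (First⇒∈ f))
  First-agree (new avoid _) (old f′)       c c′ = contradiction c′ (All.lookup avoid (First⇒∈ f′))
  First-agree (new _ _)     (new _ _)      c c′ = refl

  First-unique : ∀ {P i p p′} → First P i p → First P i p′ → p ≡ p′
  First-unique f f′ = First-agree f f′ (First⇒Contains f) (First⇒Contains f′)

  -- Both boundary values are allowed: a cut just before `a` or just before `b` does not divide
  -- `[a, b)`.
  Outside : ℕ → ℕ → ℕ → Set
  Outside a b p = p ≤ a ⊎ b ≤ p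

  Seen : List ℕ → ℕ → ℕ → ℕ → Set
  Seen P a b p = ∃[ i ] EndIn a b i × First P i p

  Seen? : ∀ P a b p → Dec (Seen P a b p)
  Seen? P a b p = any? λ i → EndIn? a b i ×-dec First? P i p

  Seen⇒< : ∀ {P a b p} → Seen P a b p → p < N
  Seen⇒< (_ , _ , f) = First⇒< f

  deg : List ℕ → ℕ → ℕ → ℕ
  deg P a b = count (Seen? P a b) N

  EndIn-mono : ∀ {a b a′ b′ i} → a ≤ a′ → b′ ≤ b → EndIn a′ b′ i → EndIn a b i
  EndIn-mono a≤ ≤b = Sum.map (λ (u , v) → ≤-trans a≤ u , ≤-trans v ≤b)
                             (λ (u , v) → ≤-trans a≤ u , ≤-trans v ≤b)

  Seen-mono : ∀ {P a b a′ b′ p} → a ≤ a′ → b′ ≤ b → Seen P a′ b′ p → Seen P a b p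
  Seen-mono a≤ ≤b (i , e , f) = i , EndIn-mono a≤ ≤b e , f

  deg-mono : ∀ {P a b a′ b′} → a ≤ a′ → b′ ≤ b → deg P a′ b′ ≤ deg P a b
  deg-mono a≤ ≤b = count-mono (Seen? _ _ _) (Seen? _ _ _) N (Seen-mono a≤ ≤b)

  -- A new pillar never changes the assignment of an interval that already has a pillar, so `q` is
  -- the only one that can become seen.
  deg-∷ : ∀ q P a b → deg (q ∷ P) a b ≤ suc (deg P a b)
  deg-∷ q P a b = begin
    deg (q ∷ P) a b               ≤⟨ count-⊎ (Seen? (q ∷ P) a b) (_≟ q) (Seen? P a b) N
                                       (λ { (i , e , old f)   → inj₂ (i , e , f)
                                          ; (i , e , new _ _) → inj₁ refl }) ⟩
    count (_≟ q) N + deg P a b    ≤⟨ +-monoˡ-≤ _ (count-unique (_≟ q) N λ e e′ → trans e (sym e′)) ⟩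
    suc (deg P a b)               ∎
    where open ≤-Reasoning

  EndIn-single : ∀ {x i} → EndIn x (suc x) i → IsEndpoint i x
  EndIn-single = Sum.map (λ (u , v) → ≤-antisym u (s≤s⁻¹ v)) (λ (u , v) → ≤-antisym u (s≤s⁻¹ v))

  -- One position is an end of at most one interval, and that interval is assigned to at most one
  -- pillar.
  deg-single : ∀ P x → deg P x (suc x) ≤ 1
  deg-single P x = count-unique (Seen? P x (suc x)) N λ where
    (i , e , f) (j , e′ , f′) → case ends-unique (EndIn-single {i = i} e) (EndIn-single {i = j} e′) of λ where
      refl → First-unique f f′

  deg-suc : ∀ P a x → deg P a (suc x) ≤ suc (deg P a x)
  deg-suc P a x = begin
    deg P a (suc x)               ≤⟨ count-⊎ (Seen? P a (suc x)) (Seen? P x (suc x)) (Seen? P a x) N byEnd ⟩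
    deg P x (suc x) + deg P a x   ≤⟨ +-monoˡ-≤ _ (deg-single P x) ⟩
    suc (deg P a x)               ∎
    where
    open ≤-Reasoning
    cut : ∀ {y} → a ≤ y × y < suc x → (x ≤ y × y < suc x) ⊎ (a ≤ y × y < x)
    cut {y} (a≤y , y≤x) with y <? x
    ... | yes y<x = inj₂ (a≤y , y<x)
    ... | no  y≮x = inj₁ (≮⇒≥ y≮x , y≤x)
    byEnd : ∀ {p} → Seen P a (suc x) p → Seen P x (suc x) p ⊎ Seen P a x p
    byEnd (i , inj₁ e , f) = Sum.map (λ e → i , inj₁ e , f) (λ e → i , inj₁ e , f) (cut e)
    byEnd (i , inj₂ e , f) = Sum.map (λ e → i , inj₂ e , f) (λ e → i , inj₂ e , f) (cut e)

  Cross-sym : ∀ {i j} → Cross i j → Cross j i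
  Cross-sym = Sum.swap

  -- Of two crossing intervals, each has an end within the other. Thus every pillar that could
  -- conflict with an interval inside `[a, b)` is seen from `[a, b)`.
  Cross⇒EndIn : ∀ {a b i j} → Inside a b i → Cross i j → EndIn a b j
  Cross⇒EndIn (a≤li , ri<b) (inj₁ (li<lj , lj<ri , _)) = inj₁ (≤-trans a≤li (<⇒≤ li<lj) , <-trans lj<ri ri<b)
  Cross⇒EndIn (a≤li , ri<b) (inj₂ (_ , li<rj , rj<ri)) = inj₂ (≤-trans a≤li (<⇒≤ li<rj) , <-trans rj<ri ri<b)

  Contains-Inside : ∀ {a b i p} → Inside a b i → Outside a b p → ¬ Contains p i
  Contains-Inside (a≤l , r<b) (inj₁ p≤a) (l<p , p≤r) = <⇒≱ l<p (≤-trans p≤a a≤l)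
  Contains-Inside (a≤l , r<b) (inj₂ b≤p) (l<p , p≤r) = <⇒≱ r<b (≤-trans b≤p p≤r)

  -- Placing one pillar and joining the solutions on its two sides.

  -- A pillar and its colour for each interval inside [a, b), where κ colours the
  -- pillars of P.
  record Solution (K : ℕ) (P : List ℕ) (κ : ℕ → Fin K) (a b : ℕ) : Set where
    field
      pillar   : Fin n → ℕ
      shade    : Fin n → Fin K
      contains : ∀ {i} → Inside a b i → Contains (pillar i) i
      proper   : ∀ {i j} → Inside a b i → Inside a b j → Cross i j →
                 shade i ≡ shade j → pillar i ≡ pillar j
      avoids   : ∀ {i j p} → Inside a b i → First P j p → Cross i j → shade i ≢ κ p

  module _ {K P a b q} (κ : ℕ → Fin K) (a<q : a < q) (q<b : q < b)
           (outside : All (Outside a b) P) (few : deg P a b < K)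
           (solveˡ : ∀ κ → Solution K (q ∷ P) κ a q) (solveʳ : ∀ κ → Solution K (q ∷ P) κ q b)
           where

    private
      c : Fin K
      c = proj₁ (fresh (Seen? P a b) N κ few)

      c≢κ : ∀ {p} → Seen P a b p → c ≢ κ p
      c≢κ s = proj₂ (fresh (Seen? P a b) N κ few) (Seen⇒< s) s

      κ′ : ℕ → Fin K
      κ′ p with p ≟ q
      ... | yes _ = c
      ... | no _  = κ p

      κ′-q : κ′ q ≡ c
      κ′-q with q ≟ q
      ... | yes _  = refl
      ... | no q≢q = contradiction refl q≢q

      κ′-old : ∀ {p} → p ∈ P → κ′ p ≡ κ p
      κ′-old {p} p∈P with p ≟ q
      ... | no _     = refl
      -- `q` lies strictly between `a` and `b`, so recolouring it affects no pillar of `P`.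
      ... | yes refl = contradiction (All.lookup outside p∈P) [ <⇒≱ a<q , <⇒≱ q<b ]′

      module L = Solution (solveˡ κ′)
      module R = Solution (solveʳ κ′)

      data Side (i : Fin n) : Set where
        before : r i < q → Side i
        across : Contains q i → Side i
        after  : q ≤ l i → Side i

      side : ∀ i → Side i
      side i with r i <? q | l i <? q
      ... | yes r<q | _       = before r<q
      ... | no r≮q  | yes l<q = across (l<q , ≮⇒≥ r≮q)
      ... | no _    | no l≮q  = after (≮⇒≥ l≮q)

      fromSide : ∀ {X : Set} {i} → X → X → X → Side i → X
      fromSide x y z (before _) = x
      fromSide x y z (across _) = y
      fromSide x y z (after _)  = z

      -- No pillar of `P` divides `[a, b)`, so `q` is the oldest pillar in every inside interval
      -- that contains it.
      newest : ∀ {i} → Inside a b i → Contains q i → First (q ∷ P) i q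
      newest ins = new (All.map (Contains-Inside ins) outside)

      insˡ : ∀ {i} → Inside a b i → r i < q → Inside a q i
      insˡ ins r<q = proj₁ ins , r<q

      insʳ : ∀ {i} → Inside a b i → q ≤ l i → Inside q b i
      insʳ ins q≤l = q≤l , proj₂ ins

      apart : ∀ {i j} → r i < q → q ≤ l j → ¬ Cross i j
      apart ri<q q≤lj (inj₁ (_ , lj<ri , _)) = <⇒≱ (<-trans lj<ri ri<q) q≤lj
      apart ri<q q≤lj (inj₂ (lj<li , _ , _)) = <⇒≱ (<-trans lj<li (<-trans (l<r _) ri<q)) q≤lj

    -- The colour `c` differs from those of all pillars seen from `[a, b)`, which protects the
    -- intervals through `q`. Both sides are solved with `q` as an already coloured pillar, so they
    -- avoid `c` where they cross such intervals, and intervals on opposite sides of `q` never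
    -- cross.
    joinAt : Solution K P κ a b
    joinAt = record
      { pillar   = λ i → fromSide (L.pillar i) q (R.pillar i) (side i)
      ; shade    = λ i → fromSide (L.shade i) c (R.shade i) (side i)
      ; contains = contains
      ; proper   = proper
      ; avoids   = avoids
      }
      where
      contains : ∀ {i} → Inside a b i → Contains (fromSide (L.pillar i) q (R.pillar i) (side i)) i
      contains {i} ins with side i
      ... | before r<q = L.contains (insˡ ins r<q)
      ... | across c   = c
      ... | after q≤l  = R.contains (insʳ ins q≤l)

      proper : ∀ {i j} → Inside a b i → Inside a b j → Cross i j →
        fromSide (L.shade i) c (R.shade i) (side i) ≡ fromSide (L.shade j) c (R.shade j) (side j) →
        fromSide (L.pillar i) q (R.pillar i) (side i) ≡ fromSide (L.pillar j) q (R.pillar j) (side j)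
      proper {i} {j} insi insj x eq with side i | side j
      ... | before u | before v = L.proper (insˡ insi u) (insˡ insj v) x eq
      ... | before u | across v = contradiction (trans eq (sym κ′-q)) (L.avoids (insˡ insi u) (newest insj v) x)
      ... | before u | after v  = contradiction x (apart u v)
      ... | across u | before v = contradiction (trans (sym eq) (sym κ′-q)) (L.avoids (insˡ insj v) (newest insi u) (Cross-sym x))
      ... | across u | across v = refl
      ... | across u | after v  = contradiction (trans (sym eq) (sym κ′-q)) (R.avoids (insʳ insj v) (newest insi u) (Cross-sym x))
      ... | after u  | before v = contradiction (Cross-sym x) (apart v u)
      ... | after u  | across v = contradiction (trans eq (sym κ′-q)) (R.avoids (insʳ insi u) (newest insj v) x)
      ... | after u  | after v  = R.proper (insʳ insi u) (insʳ insj v) x eq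

      avoids : ∀ {i j p} → Inside a b i → First P j p → Cross i j →
        fromSide (L.shade i) c (R.shade i) (side i) ≢ κ p
      avoids {i} {j} ins f x with side i
      ... | before u = λ eq → L.avoids (insˡ ins u) (old f) x (trans eq (sym (κ′-old (First⇒∈ f))))
      ... | across u = c≢κ (j , Cross⇒EndIn ins x , f)
      ... | after u  = λ eq → R.avoids (insʳ ins u) (old f) x (trans eq (sym (κ′-old (First⇒∈ f))))

  -- Increasing chains of incidences, and the greedy partition of an arc.

  module _ {ω} (clique≤ω : ∀ is → AllPairs Cross is → length is ≤ ω)
           {P a b} (a<b : a < b) (outside : All (Outside a b) P) where

    -- Seen from [a, b), the pillars lie on the circle in the order: right of b, then
    -- left of a.  The key of a pillar linearises this order.
    Key : ℕ → ℕ → Set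
    Key k p = (b ≤ p × k ≡ p) ⊎ (p ≤ a × k ≡ p + N)

    -- The pillar is recovered from its key, which makes the predicate decidable. Since seen pillars
    -- are below `N`, keys below `N` belong to the right of `b` and the others to the left of `a`.
    KeySeen : ℕ → ℕ → ℕ → Set
    KeySeen x y k = (b ≤ k × Seen P x y k) ⊎ (N ≤ k × k ∸ N ≤ a × Seen P x y (k ∸ N))

    KeySeen? : ∀ x y k → Dec (KeySeen x y k)
    KeySeen? x y k = (b ≤? k ×-dec Seen? P x y k) ⊎-dec (N ≤? k ×-dec (k ∸ N ≤? a ×-dec Seen? P x y (k ∸ N)))

    KeySeen-mono : ∀ {x y x′ y′ k} → x ≤ x′ → y′ ≤ y → KeySeen x′ y′ k → KeySeen x y k
    KeySeen-mono x≤ ≤y = Sum.map (λ (u , s) → u , Seen-mono x≤ ≤y s)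
                                 (λ (u , v , s) → u , v , Seen-mono x≤ ≤y s)

    deg≤keys : ∀ x y → deg P x y ≤ count (KeySeen? x y) (N + N)
    deg≤keys x y = begin
      deg P x y                                                            ≤⟨ count-⊎ (Seen? P x y) (KeySeen? x y ∘ (_+ N)) (KeySeen? x y) N keyOf ⟩
      count (KeySeen? x y ∘ (_+ N)) N + count (KeySeen? x y) N             ≡⟨ ∑-split N N _ ⟨
      count (KeySeen? x y) (N + N)                                         ∎
      where
      open ≤-Reasoning
      keyOf : ∀ {p} → Seen P x y p → KeySeen x y (p + N) ⊎ KeySeen x y p
      keyOf {p} s@(_ , _ , f) = Sum.map
        (λ p≤a → inj₂ (m≤n+m N p , subst (λ z → z ≤ a × Seen P x y z) (sym (m+n∸n≡m p N)) (p≤a , s)))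
        (λ b≤p → inj₁ (b≤p , s))
        (All.lookup outside (First⇒∈ f))

    -- A pillar `p` has only one of the keys `p` and `p + N`, because `a < b` excludes `b ≤ p`
    -- together with `p ≤ a`.
    keys≤deg : ∀ x y → count (KeySeen? x y) (N + N) ≤ deg P x y
    keys≤deg x y = begin
      count (KeySeen? x y) (N + N)                               ≡⟨ ∑-split N N _ ⟩
      count (KeySeen? x y ∘ (_+ N)) N + count (KeySeen? x y) N   ≡⟨ ∑-+ N _ _ ⟨
      ∑ N (λ p → ind (KeySeen? x y (p + N)) + ind (KeySeen? x y p)) ≤⟨ ∑-mono N (λ {p} p<N →
          ind-disjoint (proj₂ ∘ leftKey) (proj₂ ∘ rightKey p<N)
            (λ s t → <⇒≱ a<b (≤-trans (proj₁ (rightKey p<N t)) (proj₁ (leftKey s))))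
            (KeySeen? x y (p + N)) (KeySeen? x y p) (Seen? P x y p)) ⟩
      deg P x y                                                  ∎
      where
      open ≤-Reasoning
      leftKey : ∀ {p} → KeySeen x y (p + N) → p ≤ a × Seen P x y p
      leftKey {p} (inj₁ (_ , s))     = contradiction (Seen⇒< s) (≤⇒≯ (m≤n+m N p))
      leftKey {p} (inj₂ (_ , u , s)) = subst (λ z → z ≤ a × Seen P x y z) (m+n∸n≡m p N) (u , s)
      rightKey : ∀ {p} → p < N → KeySeen x y p → b ≤ p × Seen P x y p
      rightKey p<N (inj₁ s)         = s
      rightKey p<N (inj₂ (N≤p , _)) = contradiction p<N (≤⇒≯ N≤p)

    record Link (i : Fin n) (e k : ℕ) : Set where
      no-eta-equality
      pattern
      constructor link
      field
        {p}   : ℕ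
        end   : IsEndpoint i e
        a≤e   : a ≤ e
        e<b   : e < b
        first : First P i p
        key   : Key k p

    KeySeen⇒Link : ∀ {x y k} → a ≤ x → y ≤ b → KeySeen x y k → ∃[ i ] ∃[ e ] x ≤ e × e < y × Link i e k
    KeySeen⇒Link {x} {y} {k} a≤x y≤b = go
      where
      fromEnd : ∀ {i p} → EndIn x y i → First P i p → Key k p → ∃[ i ] ∃[ e ] x ≤ e × e < y × Link i e k
      fromEnd (inj₁ (u , v)) f κ = _ , _ , u , v , link (inj₁ refl) (≤-trans a≤x u) (<-≤-trans v y≤b) f κ
      fromEnd (inj₂ (u , v)) f κ = _ , _ , u , v , link (inj₂ refl) (≤-trans a≤x u) (<-≤-trans v y≤b) f κ
      go : KeySeen x y k → ∃[ i ] ∃[ e ] x ≤ e × e < y × Link i e k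
      go (inj₁ (b≤k , i , e , f))       = fromEnd e f (inj₁ (b≤k , refl))
      go (inj₂ (N≤k , k≤a , i , e , f)) = fromEnd e f (inj₂ (k≤a , sym (m∸n+n≡m N≤k)))

    -- An interval containing a pillar at or beyond `b` has its right end there too, so only its
    -- left end can lie before `b`.
    rightEnd : ∀ {i e p} → IsEndpoint i e → e < b → b ≤ p → Contains p i → e ≡ l i
    rightEnd (inj₁ eq)   _   _   _         = eq
    rightEnd (inj₂ refl) e<b b≤p (_ , p≤r) = contradiction e<b (≤⇒≯ (≤-trans b≤p p≤r))

    leftEnd : ∀ {i e p} → IsEndpoint i e → a ≤ e → p ≤ a → Contains p i → e ≡ r i
    leftEnd (inj₂ eq)   _   _   _         = eq
    leftEnd (inj₁ refl) a≤e p≤a (l<p , _) = contradiction l<p (≤⇒≯ (≤-trans p≤a a≤e))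

    -- If two such intervals were nested, each would contain both pillars, and First-agree
    -- would identify the pillars.
    links-cross : ∀ {i j e e′ k k′} → Link i e k → Link j e′ k′ → e < e′ → k < k′ → Cross i j
    links-cross {i} {j} (link {p} end a≤e e<b f (inj₁ (b≤p , refl))) (link {p′} end′ a≤e′ e′<b f′ (inj₁ (b≤p′ , refl))) e<e′ p<p′
      with rightEnd end e<b b≤p (First⇒Contains f) | rightEnd end′ e′<b b≤p′ (First⇒Contains f′)
    ... | refl | refl with r i <? r j
    ...   | yes ri<rj = inj₁ (e<e′ , <-≤-trans e′<b (≤-trans b≤p (proj₂ (First⇒Contains f))) , ri<rj)
    ...   | no ri≮rj  = contradiction
            (First-agree f f′
              (<-≤-trans e′<b b≤p , ≤-trans (<⇒≤ p<p′) (proj₂ (First⇒Contains f′)))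
              (<-trans e<e′ (proj₁ (First⇒Contains f′)) , ≤-trans (proj₂ (First⇒Contains f′)) (≮⇒≥ ri≮rj)))
            (<⇒≢ p<p′)
    links-cross {i} {j} (link end a≤e e<b f (inj₁ (b≤p , refl))) (link end′ a≤e′ e′<b f′ (inj₂ (p′≤a , refl))) e<e′ _
      with rightEnd end e<b b≤p (First⇒Contains f) | leftEnd end′ a≤e′ p′≤a (First⇒Contains f′)
    ... | refl | refl = inj₂
            ( <-≤-trans (proj₁ (First⇒Contains f′)) (≤-trans p′≤a a≤e)
            , e<e′
            , <-≤-trans e′<b (≤-trans b≤p (proj₂ (First⇒Contains f))))
    links-cross (link {p} _ _ _ _ (inj₂ (_ , refl))) (link {p′} _ _ _ f′ (inj₁ (_ , refl))) _ k<k′ =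
      contradiction (<-trans k<k′ (First⇒< f′)) (≤⇒≯ (m≤n+m N p))
    links-cross {i} {j} (link {p} end a≤e e<b f (inj₂ (p≤a , refl))) (link {p′} end′ a≤e′ e′<b f′ (inj₂ (p′≤a , refl))) e<e′ k<k′
      with leftEnd end a≤e p≤a (First⇒Contains f) | leftEnd end′ a≤e′ p′≤a (First⇒Contains f′)
    ... | refl | refl with l i <? l j
    ...   | yes li<lj = inj₁ (li<lj , <-≤-trans (proj₁ (First⇒Contains f′)) (≤-trans p′≤a a≤e) , e<e′)
    ...   | no li≮lj  = contradiction
            (First-agree f f′
              (≤-<-trans (≮⇒≥ li≮lj) (proj₁ (First⇒Contains f)) , ≤-trans (<⇒≤ p<p′) (proj₂ (First⇒Contains f′)))
              (<-trans (proj₁ (First⇒Contains f)) p<p′ , ≤-trans p′≤a a≤e))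
            (<⇒≢ p<p′)
      where
      p<p′ : p < p′
      p<p′ = +-cancelʳ-< N p p′ k<k′

    -- Stands for a strictly increasing chain of `h` incidences below `(x, k)`: the list keeps the
    -- clique that such a chain yields, and the bounds on ends and keys allow a larger incidence to
    -- be put in front.
    record Chain (x k h : ℕ) : Set where
      no-eta-equality
      pattern
      constructor chain
      field
        members : List (Fin n)
        size    : length members ≡ h
        crosses : AllPairs Cross members
        links   : All (λ i → ∃[ e ] ∃[ k′ ] e < x × k′ < k × Link i e k′) members

    chain≤ω : ∀ {x k h} → Chain x k h → h ≤ ω
    chain≤ω (chain is refl cr _) = clique≤ω is cr

    chain-weaken : ∀ {x y k k′ h} → x ≤ y → k ≤ k′ → Chain x k h → Chain y k′ h
    chain-weaken x≤y k≤k′ (chain is s cr ls) = chain is s cr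
      (All.map (λ (e , k , e<x , u , lk) → e , k , <-≤-trans e<x x≤y , <-≤-trans u k≤k′ , lk) ls)

    -- The new incidence exceeds every member in both end and key, so by `links-cross` its interval
    -- crosses them all.
    chain-extend : ∀ {x y k h} → a ≤ x → x ≤ y → y ≤ b → KeySeen x y k → Chain x k h → Chain y (suc k) (suc h)
    chain-extend {k = k} a≤x x≤y y≤b s c@(chain is size cr ls) with KeySeen⇒Link a≤x y≤b s
    ... | i , e , x≤e , e<y , lk = chain (i ∷ is) (cong suc size)
          (All.map (λ (e′ , k′ , e′<x , k′<k , lk′) → Cross-sym (links-cross lk′ lk (<-≤-trans e′<x x≤e) k′<k)) ls ∷ cr)
          ((e , k , e<y , ≤-refl , lk) ∷ Chain.links (chain-weaken x≤y (n≤1+n k) c))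

    -- The table of the usual dynamic program for longest increasing chains, with a chain attesting
    -- each entry.
    record Heights (x : ℕ) (H : ℕ → ℕ) : Set where
      no-eta-equality
      pattern
      constructor heights
      field
        monotone : ∀ k → H k ≤ H (suc k)
        chains   : ∀ k → Chain x k (H k)

    -- Over all keys this is at most ω times the degree of `[a, b)`, while each piece seeing `d`
    -- pillars raises it by at least `d - ω`. Comparing the two bounds the number of full pieces.
    potential : (ℕ → ℕ) → ℕ → ℕ
    potential H K = ∑ K (λ k → ind (KeySeen? a b k) * H (suc k))

    heights₀ : ∀ x → Heights x (const 0)
    heights₀ x = heights (λ _ → z≤n) (λ _ → chain [] refl [] [])

    potential≤ : ∀ {x H} → Heights x H → potential H (N + N) ≤ ω * deg P a b
    potential≤ {H = H} (heights _ chains) = begin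
      potential H (N + N)                                   ≤⟨ ∑-mono (N + N) (λ {k} _ → ≤-trans (*-monoʳ-≤ (ind (KeySeen? a b k)) (chain≤ω (chains (suc k)))) (≤-reflexive (*-comm _ ω))) ⟩
      ∑ (N + N) (λ k → ω * ind (KeySeen? a b k))            ≡⟨ ∑-*ˡ ω (N + N) _ ⟩
      ω * count (KeySeen? a b) (N + N)                      ≤⟨ *-monoʳ-≤ ω (keys≤deg a b) ⟩
      ω * deg P a b                                         ∎
      where open ≤-Reasoning

    module _ {x y H} (a≤x : a ≤ x) (x≤y : x ≤ y) (y≤b : y ≤ b) (Hs : Heights x H) where
      open Heights Hs

      private
        bump : ∀ k → Dec (KeySeen x y k) → ℕ
        bump k (yes _) = suc (H k)
        bump k (no _)  = 0

      -- A chain gains at most one incidence from the piece `[x, y)`, hence `bump` builds on the old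
      -- height `H k`. The maximum with `raise k` keeps the table monotone.
      raise : ℕ → ℕ
      raise zero    = 0
      raise (suc k) = H (suc k) ⊔ bump k (KeySeen? x y k) ⊔ raise k

      private
        ⊔-chain : ∀ {x k m n} → Chain x k m → Chain x k n → Chain x k (m ⊔ n)
        ⊔-chain {m = m} {n} c d with ⊔-sel m n
        ... | inj₁ eq = subst (Chain _ _) (sym eq) c
        ... | inj₂ eq = subst (Chain _ _) (sym eq) d

        bump-chain : ∀ k s → Chain y (suc k) (bump k s)
        bump-chain k (yes s) = chain-extend a≤x x≤y y≤b s (chains k)
        bump-chain k (no _)  = chain [] refl [] []

        raise-chain : ∀ k → Chain y k (raise k)
        raise-chain zero    = chain [] refl [] []
        raise-chain (suc k) = ⊔-chain
          (⊔-chain (chain-weaken x≤y ≤-refl (chains (suc k))) (bump-chain k (KeySeen? x y k)))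
          (chain-weaken ≤-refl (n≤1+n k) (raise-chain k))

      raise-heights : Heights y raise
      raise-heights = heights (λ k → m≤n⊔m _ (raise k)) raise-chain

      private
        -- The share of one key in the telescoping sum: a key seen from the piece rises from
        -- `H (suc k)` to at least `suc (H k)`. For other keys monotonicity suffices.
        slot : ∀ k (s : Dec (KeySeen x y k)) (v : Dec (KeySeen a b k)) {h} → H (suc k) ≤ h → bump k s ≤ h →
          ind v * H (suc k) + ind s + H k ≤ ind v * h + H (suc k)
        slot k (yes s) (yes v) {h} Hk≤h b≤h = begin
          1 * H (suc k) + 1 + H k   ≡⟨ rearrange (H (suc k)) (H k) ⟩
          suc (H k) + H (suc k)     ≤⟨ +-monoˡ-≤ (H (suc k)) b≤h ⟩
          h + H (suc k)             ≡⟨ cong (_+ H (suc k)) (*-identityˡ h) ⟨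
          1 * h + H (suc k)         ∎
          where
          open ≤-Reasoning
          rearrange : ∀ u v → 1 * u + 1 + v ≡ suc v + u
          rearrange = solve-∀
        slot k (no _) (yes v) {h} Hk≤h b≤h =
          +-mono-≤ (≤-trans (≤-reflexive (+-identityʳ _)) (*-monoʳ-≤ 1 Hk≤h)) (monotone k)
        slot k (yes s) (no ¬v) _ _ = contradiction (KeySeen-mono a≤x y≤b s) ¬v
        slot k (no _) (no _) _ _ = monotone k

      -- Summing H (k + 1) - H k over the keys telescopes to at most H K.
      raise-potential : ∀ K → potential H K + count (KeySeen? x y) K ≤ potential raise K + H K
      raise-potential zero    = z≤n
      raise-potential (suc k) = begin
        (u + potential H k) + (s + count (KeySeen? x y) k)     ≡⟨ rearrange u _ s _ ⟩
        (u + s) + (potential H k + count (KeySeen? x y) k)     ≤⟨ +-monoʳ-≤ (u + s) (raise-potential k) ⟩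
        (u + s) + (potential raise k + H k)                    ≡⟨ rearrange′ (u + s) _ _ ⟩
        (u + s + H k) + potential raise k                      ≤⟨ +-monoˡ-≤ _ (slot k (KeySeen? x y k) (KeySeen? a b k)
                                                                   (≤-trans (m≤m⊔n _ _) (m≤m⊔n _ (raise k)))
                                                                   (≤-trans (m≤n⊔m (H (suc k)) _) (m≤m⊔n _ (raise k)))) ⟩
        (w + H (suc k)) + potential raise k                    ≡⟨ rearrange″ w _ _ ⟩
        (w + potential raise k) + H (suc k)                    ∎
        where
        open ≤-Reasoning
        u s w : ℕ
        u = ind (KeySeen? a b k) * H (suc k)
        s = ind (KeySeen? x y k)
        w = ind (KeySeen? a b k) * raise (suc k)
        rearrange : ∀ u p s c → (u + p) + (s + c) ≡ (u + s) + (p + c)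
        rearrange = solve-∀
        rearrange′ : ∀ u p h → u + (p + h) ≡ (u + h) + p
        rearrange′ = solve-∀
        rearrange″ : ∀ w h p → (w + h) + p ≡ (w + p) + h
        rearrange″ = solve-∀

      -- Over all keys, the telescoped increments of `H` amount to at most ω, since every height is
      -- the size of a clique.
      raise-gain : potential H (N + N) + deg P x y ≤ potential raise (N + N) + ω
      raise-gain = begin
        potential H (N + N) + deg P x y                           ≤⟨ +-monoʳ-≤ (potential H (N + N)) (deg≤keys x y) ⟩
        potential H (N + N) + count (KeySeen? x y) (N + N)        ≤⟨ raise-potential (N + N) ⟩
        potential raise (N + N) + H (N + N)                       ≤⟨ +-monoʳ-≤ (potential raise (N + N)) (chain≤ω (chains (N + N))) ⟩
        potential raise (N + N) + ω                               ∎
        where open ≤-Reasoning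

    private
      t : ℕ
      t = 3 * ω

    -- A partition in progress: the closed pieces all see at least t pillars, except
    -- perhaps the first one.
    record Greedy (f x : ℕ) : Set where
      field
        {closed cut} : ℕ
        {H}            : ℕ → ℕ
        pieces         : Pieces (λ x y → deg P x y ≤ t × y ≤ f + x) closed a cut
        a<cut        : a < cut
        cut<x        : cut < x
        open-deg       : deg P cut x ≤ t
        hts            : Heights cut H
        potential≥     : 2 * ω * closed ≤ potential H (N + N)

    -- The scan advances by one position and cuts just before the open piece would see more than `t`
    -- pillars. The bound `y ≤ f + x` makes the pieces short enough for the later recursion on
    -- length.
    greedy : ∀ {f} → 1 ≤ ω → b ≤ suc f + a → ∀ d → d + suc (suc a) ≤ b → Greedy f (d + suc (suc a))
    greedy {f} 1≤ω b≤ zero ≤b = record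
      -- The first piece is the single position `a`. Every later piece then starts after `a` and is
      -- therefore shorter than `[a, b)`.
      { pieces     = one ≤-refl (≤-trans (deg-single P a) 1≤t , ≤-trans (s≤s⁻¹ (≤-trans ≤b b≤)) ≤-refl)
      ; a<cut    = ≤-refl
      ; cut<x    = ≤-refl
      ; open-deg   = ≤-trans (deg-single P (suc a)) 1≤t
      ; hts        = heights₀ (suc a)
      ; potential≥ = ≤-trans (≤-reflexive (*-zeroʳ (2 * ω))) z≤n
      }
      where
      1≤t : 1 ≤ t
      1≤t = ≤-trans 1≤ω (m≤m+n ω _)
    greedy {f} 1≤ω b≤ (suc d) ≤b with greedy 1≤ω b≤ d (<⇒≤ ≤b)
    ... | g with deg P (Greedy.cut g) (suc (d + suc (suc a))) ≤? t
    ...   | yes ok = record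
      { pieces = pieces ; a<cut = a<cut ; cut<x = m≤n⇒m≤1+n cut<x ; open-deg = ok
      ; hts = hts ; potential≥ = potential≥ }
      where open Greedy g
    ...   | no full = record
      { pieces     = snoc pieces cut<x (open-deg , ≤-trans (<⇒≤ ≤b) (≤-trans b≤ (≤-trans (≤-reflexive (sym (+-suc f a))) (+-monoʳ-≤ f a<cut))))
      ; a<cut    = <-trans a<cut cut<x
      ; cut<x    = ≤-refl
      ; open-deg   = ≤-trans (deg-single P _) (≤-trans 1≤ω (m≤m+n ω _))
      ; hts        = raise-heights (<⇒≤ a<cut) (<⇒≤ cut<x) (<⇒≤ ≤b) hts
      -- One further position adds at most one seen pillar, so the piece being closed already sees
      -- 3ω of them. By `raise-gain` the potential grows by at least 3ω - ω = 2ω.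
      ; potential≥ = +-cancelʳ-≤ ω _ _ (begin
          2 * ω * suc closed + ω                                  ≡⟨ rearrange ω closed ⟩
          2 * ω * closed + t                                      ≤⟨ +-mono-≤ potential≥ (s≤s⁻¹ (≤-trans (≰⇒> full) (deg-suc P cut _))) ⟩
          potential H (N + N) + deg P cut (d + suc (suc a))     ≤⟨ raise-gain (<⇒≤ a<cut) (<⇒≤ cut<x) (<⇒≤ ≤b) hts ⟩
          _                                                       ∎)
      }
      where
      open Greedy g
      open ≤-Reasoning
      rearrange : ∀ w c → 2 * w * suc c + w ≡ 2 * w * c + 3 * w
      rearrange = solve-∀

    partition : ∀ {f} → 1 ≤ ω → deg P a b ≤ 5 * ω → suc (suc a) ≤ b → b ≤ suc f + a →
      ∃[ m ] suc m ≤ 2 ^ (2 * ω) × Pieces (λ x y → deg P x y ≤ t × y ≤ f + x) m a b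
    partition {f} 1≤ω deg≤ 2+a≤b b≤ =
      suc closed , pieces-few 1≤ω 2c≤5ω ,
      snoc pieces cut<x (open-deg , ≤-trans b≤ (≤-trans (≤-reflexive (sym (+-suc f a))) (+-monoʳ-≤ f a<cut)))
      where
      g : Greedy f b
      g = subst (Greedy f) (m∸n+n≡m 2+a≤b) (greedy 1≤ω b≤ (b ∸ suc (suc a)) (≤-reflexive (m∸n+n≡m 2+a≤b)))
      open Greedy g
      open ≤-Reasoning
      2c≤5ω : 2 * closed ≤ 5 * ω
      2c≤5ω = *-cancelˡ-≤ ω {{>-nonZero 1≤ω}} (begin
        ω * (2 * closed)         ≡⟨ rearrange ω closed ⟩
        2 * ω * closed           ≤⟨ potential≥ ⟩
        potential H (N + N)      ≤⟨ potential≤ hts ⟩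
        ω * deg P a b            ≤⟨ *-monoʳ-≤ ω deg≤ ⟩
        ω * (5 * ω)              ∎)
        where
        rearrange : ∀ w c → w * (2 * c) ≡ 2 * w * c
        rearrange = solve-∀

  -- Balanced refinement and the recursive colouring of the pillars.

  module _ {ω} (1≤ω : 1 ≤ ω) (clique≤ω : ∀ is → AllPairs Cross is → length is ≤ ω) where

    -- Cutting along a balanced binary tree adds only d pillars to each path.
    refine : ∀ {f P A B} → deg P A B ≤ 5 * ω →
      (∀ {Q a b} → b ≤ f + a → All (Outside a b) Q → deg Q a b ≤ 5 * ω → ∀ κ → Solution (7 * ω) Q κ a b) →
      ∀ d {k m a b Q} → d + k ≤ 2 * ω → suc m ≤ 2 ^ d → A ≤ a → b ≤ B →
      Pieces (λ x y → deg P x y ≤ 3 * ω × y ≤ f + x) m a b →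
      All (Outside a b) Q → (∀ x y → deg Q x y ≤ k + deg P x y) →
      ∀ κ → Solution (7 * ω) Q κ a b
    refine {P = P} degP solve d {k} {zero} {a} {b} {Q} d+k≤ _ _ _ (one _ (deg≤ , b≤)) outside degQ =
      solve b≤ outside (begin
        deg Q a b             ≤⟨ degQ a b ⟩
        k + deg P a b         ≤⟨ +-mono-≤ (m+n≤o⇒n≤o d d+k≤) deg≤ ⟩
        2 * ω + 3 * ω         ≡⟨ *-distribʳ-+ ω 2 3 ⟨
        5 * ω                 ∎)
      where open ≤-Reasoning
    refine degP solve zero {m = suc m} _ (s≤s ())
    refine {P = P} {A} {B} degP solve (suc d) {k} {suc m} {a} {b} {Q} d+k≤ m≤ A≤a b≤B ps outside degQ κ
      with split ⌊ m /2⌋ (subst (λ z → Pieces _ (suc z) a b) (sym (trans (+-comm ⌈ m /2⌉ _) (⌊n/2⌋+⌈n/2⌉≡n m))) ps)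
    ... | c , psˡ , psʳ =
      joinAt κ a<c c<b outside few
        (refine degP solve d d+k≤′ (≤-trans (s≤s (⌊n/2⌋≤⌈n/2⌉ m)) half) A≤a (≤-trans (<⇒≤ c<b) b≤B) psˡ
          (inj₂ ≤-refl ∷ All.map (Sum.map₂ (≤-trans (<⇒≤ c<b))) outside) degcQ)
        (refine degP solve d d+k≤′ half (≤-trans A≤a (<⇒≤ a<c)) b≤B psʳ
          (inj₁ ≤-refl ∷ All.map (Sum.map₁ (λ p≤a → ≤-trans p≤a (<⇒≤ a<c))) outside) degcQ)
      where
      open ≤-Reasoning
      a<c : a < c
      a<c = pieces-< psˡ
      c<b : c < b
      c<b = pieces-< psʳ
      d+k≤′ : d + suc k ≤ 2 * ω
      d+k≤′ = subst (_≤ 2 * ω) (sym (+-suc d k)) d+k≤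
      half : suc ⌈ m /2⌉ ≤ 2 ^ d
      half = begin
        ⌈ suc (suc m) /2⌉           ≤⟨ ⌈n/2⌉-mono m≤ ⟩
        ⌈ 2 ^ d + (2 ^ d + 0) /2⌉   ≡⟨ cong (λ z → ⌈ 2 ^ d + z /2⌉) (+-identityʳ (2 ^ d)) ⟩
        ⌈ 2 ^ d + 2 ^ d /2⌉         ≡⟨ n≡⌈n+n/2⌉ (2 ^ d) ⟨
        2 ^ d                       ∎
      degcQ : ∀ x y → deg (c ∷ Q) x y ≤ suc k + deg P x y
      degcQ x y = ≤-trans (deg-∷ c Q x y) (s≤s (degQ x y))
      -- The depth still available includes the present cut, so `k` is strictly below 2ω and a
      -- colour is free.
      few : deg Q a b < 7 * ω
      few = begin-strict
        deg Q a b             ≤⟨ degQ a b ⟩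
        k + deg P a b         <⟨ +-mono-<-≤ (m+n≤o⇒n≤o d d+k≤′) (≤-trans (deg-mono {P} A≤a b≤B) degP) ⟩
        2 * ω + 5 * ω         ≡⟨ *-distribʳ-+ ω 2 5 ⟨
        7 * ω                 ∎

    -- Induction on the length bound `f`: the pieces of the partition are shorter, and `refine`
    -- restores the bound 5ω on what each of them sees.
    solution : ∀ f {P a b} → b ≤ f + a → All (Outside a b) P → deg P a b ≤ 5 * ω →
      ∀ κ → Solution (7 * ω) P κ a b
    solution f {a = a} {b} _ _ _ κ with b ≤? suc a
    ... | yes b≤1+a = record
      -- An arc of at most one position contains no interval, so `l` and `κ 0` are arbitrary
      -- defaults.
      { pillar   = l
      ; shade    = λ _ → κ 0
      ; contains = λ ins → ⊥-elim (empty ins)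
      ; proper   = λ ins → ⊥-elim (empty ins)
      ; avoids   = λ ins → ⊥-elim (empty ins)
      }
      where
      empty : ∀ {i} → ¬ Inside a b i
      empty {i} (a≤l , r<b) = <⇒≱ (≤-<-trans a≤l (l<r i)) (s≤s⁻¹ (≤-trans r<b b≤1+a))
    solution zero b≤ _ _ κ | no b≰1+a = contradiction (m≤n⇒m≤1+n b≤) b≰1+a
    solution (suc f) {P} {a} {b} b≤ outside deg≤ κ | no b≰1+a =
      let m , m≤ , ps = partition clique≤ω {P} {a} {b} (<-trans (n<1+n _) (≰⇒> b≰1+a)) outside {f} 1≤ω deg≤ (≰⇒> b≰1+a) b≤
      in refine {f} {P} {a} {b} deg≤ (solution f) (2 * ω) {0} {m} {a} {b} {P}
           (≤-reflexive (+-identityʳ (2 * ω))) m≤ ≤-refl ≤-refl ps outside (λ _ _ → ≤-refl) κ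

  -- Colouring the intervals of one pillar, and the product colouring.

  -- Intervals sharing a pillar cross exactly when they are comparable in ≺, so they are
  -- coloured by the length of the longest ≺-chain below them.
  module _ {ω} (clique≤ω : ∀ is → AllPairs Cross is → length is ≤ ω)
           (π : Fin n → ℕ) (contains : ∀ i → Contains (π i) i) where

    infix 4 _≺_ _≼_

    _≺_ : Rel (Fin n) 0ℓ
    i ≺ j = l i < l j × r i < r j × π i ≡ π j

    ≺-trans : ∀ {i j k} → i ≺ j → j ≺ k → i ≺ k
    ≺-trans (u , v , e) (u′ , v′ , e′) = <-trans u u′ , <-trans v v′ , trans e e′

    -- The common pillar lies in both intervals, so `l j < r i`.
    ≺⇒Cross : ∀ {i j} → i ≺ j → Cross j i
    ≺⇒Cross {i} {j} (u , v , e) =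
      inj₂ (u , <-≤-trans (proj₁ (contains j)) (subst (_≤ r i) e (proj₂ (contains i))) , v)

    _≼_ : Rel (Fin n) 0ℓ
    j ≼ i = j ≡ i ⊎ j ≺ i

    Above : ℕ → Fin n → Set
    Above zero    i = ⊤
    Above (suc h) i = ∃[ j ] j ≺ i × Above h j

    Above? : ∀ h i → Dec (Above h i)
    Above? zero    i = yes tt
    Above? (suc h) i = any? λ j → (l j <? l i ×-dec (r j <? r i ×-dec π j ≟ π i)) ×-dec Above? h j

    -- Members of a chain cross pairwise. Counting `i` itself gives `suc h` of them, which keeps
    -- every height below ω.
    above-clique : ∀ h {i} → Above h i →
      ∃[ is ] (length is ≡ suc h × AllPairs Cross is × All (_≼ i) is)
    above-clique zero    {i} _ = i ∷ [] , refl , [] ∷ [] , inj₁ refl ∷ []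
    above-clique (suc h) {i} (j , j≺i , ab) with above-clique h ab
    ... | is , len , cr , bel = i ∷ is , cong suc len , All.map ≺⇒Cross below ∷ cr , inj₁ refl ∷ All.map inj₂ below
      where
      below : All (_≺ i) is
      below = All.map [ (λ { refl → j≺i }) , (λ k≺j → ≺-trans k≺j j≺i) ]′ bel

    ¬Above-ω : ∀ {i} → ¬ Above ω i
    ¬Above-ω ab with above-clique ω ab
    ... | is , len , cr , _ = <⇒≱ (subst (ω <_) (sym len) ≤-refl) (clique≤ω is cr)

    height : ∀ i → ∃[ h ] h < ω × Above h i × ¬ Above (suc h) i
    height i = search ω ¬Above-ω
      where
      search : ∀ m → ¬ Above m i → ∃[ h ] h < m × Above h i × ¬ Above (suc h) i
      search zero    ¬ab = contradiction tt ¬ab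
      search (suc m) ¬ab with Above? m i
      ... | yes ab  = m , ≤-refl , ab , ¬ab
      ... | no ¬ab′ = let h , h<m , p = search m ¬ab′ in h , m≤n⇒m≤1+n h<m , p

    level : Fin n → Fin ω
    level i = fromℕ< (proj₁ (proj₂ (height i)))

    -- A longest chain below `i`, extended by `i`, lies below `j`, so equal levels would contradict
    -- maximality at `j`.
    level-≺ : ∀ {i j} → i ≺ j → level i ≢ level j
    level-≺ {i} {j} i≺j eq with height i | height j
    ... | h , h<ω , ab , _ | h′ , h′<ω , _ , ¬ab′ with Fin.fromℕ<-injective _ _ h<ω h′<ω eq
    ...   | refl = ¬ab′ (i , i≺j , ab)

    level-proper : ∀ {i j} → Cross i j → π i ≡ π j → level i ≢ level j
    level-proper (inj₁ (u , _ , v)) e = level-≺ (u , v , e)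
    level-proper (inj₂ (u , _ , v)) e = level-≺ (u , v , sym e) ∘ sym

  -- Crossing intervals whose pillars have the same colour share their pillar, and then their levels
  -- differ.
  colouring : ∀ {ω} → 1 ≤ ω → (∀ is → AllPairs Cross is → length is ≤ ω) →
    Σ (Fin n → Fin (7 * ω * ω)) λ c → ∀ {i j} → Cross i j → c i ≢ c j
  colouring {ω} 1≤ω clique≤ω = (λ i → combine (shade i) (level′ i)) , λ {i} {j} x eq →
    let eq₁ , eq₂ = Fin.combine-injective (shade i) (level′ i) (shade j) (level′ j) eq
    in level-proper clique≤ω pillar contained x (proper whole whole x eq₁) eq₂
    where
    noneSeen : deg [] 0 N ≤ 5 * ω
    noneSeen = ≤-trans (≤-reflexive (count-none (Seen? [] 0 N) N λ { _ (_ , _ , ()) })) z≤n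
    -- No pillar has been placed yet, so any colour serves as a default.
    someColour : Fin (7 * ω)
    someColour = fromℕ< (≤-trans 1≤ω (m≤m+n ω _))
    open Solution (solution 1≤ω clique≤ω N {[]} (≤-reflexive (sym (+-identityʳ N))) [] noneSeen (const someColour))
    whole : ∀ {i} → Inside 0 N i
    whole {i} = z≤n , r<N i
    contained : ∀ i → Contains (pillar i) i
    contained i = contains whole
    level′ : Fin n → Fin ω
    level′ = level clique≤ω pillar contained

-- The strict order of the reals.

<ᴿ-irrefl : ∀ {x} → ¬ x <ᴿ x
<ᴿ-irrefl {x} (q , u , l) = disjoint x q (l , u)

lower<upper : ∀ x {q r} → Lower x q → Upper x r → q ℚ.< r
lower<upper x {q} {r} l u with ℚ.<-cmp q r
... | tri< q<r _ _  = q<r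
... | tri≈ _ refl _ = contradiction (l , u) (disjoint x q)
... | tri> _ _ r<q  = contradiction (Equivalence.from (lower-rounded x r) (q , r<q , l) , u) (disjoint x r)

<ᴿ-trans : ∀ {x y z} → x <ᴿ y → y <ᴿ z → x <ᴿ z
<ᴿ-trans {y = y} {z} (q , ux , ly) (r , uy , lz) =
  q , ux , Equivalence.from (lower-rounded z q) (r , lower<upper y ly uy , lz)

<ᴿ-dense : ∀ {x y} → x <ᴿ y → ∃[ z ] x <ᴿ z × z <ᴿ y
<ᴿ-dense {x} {y} (q , ux , ly) =
  fromℚ q ,
  (let r , r<q , u = Equivalence.to (upper-rounded x q) ux in r , u , r<q) ,
  (let r , q<r , l = Equivalence.to (lower-rounded y q) ly in r , q<r , l)

¬¬-∀ : ∀ {a n} {P : Fin n → Set a} → (∀ i → ¬ ¬ P i) → ¬ ¬ (∀ i → P i)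
¬¬-∀ = Fin.sequence (RawMonad.rawApplicative ¬¬-Monad)

-- From interval systems to chord diagrams by ranking the ends.

module _ (𝓘 : IntervalSystem) where

  open IntervalSystem 𝓘

  private
    n = size

    End : Set
    End = Fin n ⊎ Fin n

    pt : End → ℝ
    pt = [ left ∘ interval , right ∘ interval ]′

    owner : End → Fin n
    owner = [ id , id ]′

    ¬¬-∀End : ∀ {a} {P : End → Set a} → (∀ s → ¬ ¬ P s) → ¬ ¬ (∀ s → P s)
    ¬¬-∀End {P = P} h = ¬¬-map (λ f s → subst P (Fin.splitAt-join n n s) (f (join n n s)))
                               (¬¬-∀ (h ∘ splitAt n))

  -- There are only finitely many comparisons, so excluded middle holds for all of them at once
  -- under double negation.
  ends-comparable : ¬ ¬ (∀ s t → Dec (pt s <ᴿ pt t))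
  ends-comparable = ¬¬-∀End λ s → ¬¬-∀End λ t → ¬¬-excluded-middle

  module _ (lt? : ∀ s t → Dec (pt s <ᴿ pt t)) where

    private
      below : End → Subset (n + n)
      below s = Vec.tabulate (λ k → does (lt? (splitAt n k) s))

      below⁺ : ∀ {k s} → pt (splitAt n k) <ᴿ pt s → k ∈ˢ below s
      below⁺ {k} {s} lt = lookup⇒[]= k (below s) (trans (lookup∘tabulate _ k) (dec-true (lt? (splitAt n k) s) lt))

      below⁻ : ∀ {k s} → k ∈ˢ below s → pt (splitAt n k) <ᴿ pt s
      below⁻ {k} {s} k∈ with lt? (splitAt n k) s | trans (sym (lookup∘tabulate _ k)) ([]=⇒lookup k∈)
      ... | yes lt | _  = lt
      ... | no _   | ()

      rank : End → ℕ
      rank s = ∣ below s ∣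

      -- The end `s` is below `t` but not below itself, which makes the inclusion of the two sets
      -- strict.
      rank-< : ∀ {s t} → pt s <ᴿ pt t → rank s < rank t
      rank-< {s} {t} s<t = p⊂q⇒∣p∣<∣q∣
        ( (λ {k} k∈ → below⁺ (<ᴿ-trans {pt (splitAt n k)} {pt s} {pt t} (below⁻ k∈) s<t))
        , join n n s
        , below⁺ (subst (λ u → pt u <ᴿ pt t) (sym (Fin.splitAt-join n n s)) s<t)
        , λ k∈ → <ᴿ-irrefl {pt s} (subst (λ u → pt u <ᴿ pt s) (Fin.splitAt-join n n s) (below⁻ k∈)))

      isEnd : ∀ {x} s → x ≈ᴿ pt s → IsEnd (interval (owner s)) x
      isEnd (inj₁ i) eq = isLeft eq
      isEnd (inj₂ i) eq = isRight eq

      -- Two ends with neither below the other are equal in the sense of `≈ᴿ`, which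
      -- `no-shared-ends` forbids for distinct owners.
      separated : ∀ s t → owner s ≢ owner t → pt s <ᴿ pt t ⊎ pt t <ᴿ pt s
      separated s t s≢t with lt? s t | lt? t s
      ... | yes s<t | _       = inj₁ s<t
      ... | no _    | yes t<s = inj₂ t<s
      ... | no s≮t  | no t≮s  = contradiction
              (isEnd s (<ᴿ-irrefl {pt s} , <ᴿ-irrefl {pt s}) , isEnd t (t≮s , s≮t))
              (no-shared-ends s≢t (pt s))

      rank-reflects : ∀ s t → owner s ≢ owner t → rank s < rank t → pt s <ᴿ pt t
      rank-reflects s t s≢t s<t with separated s t s≢t
      ... | inj₁ lt = lt
      ... | inj₂ gt = contradiction (rank-< {t} {s} gt) (<-asym s<t)

      rank-injective : ∀ s t → rank s ≡ rank t → owner s ≡ owner t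
      rank-injective s t eq = decidable-stable (owner s Fin.≟ owner t) λ s≢t →
        [ (λ lt → <⇒≢ (rank-< {s} {t} lt) eq) , (λ gt → <⇒≢ (rank-< {t} {s} gt) (sym eq)) ]′ (separated s t s≢t)

      rank-unique : ∀ {i j x} → x ≡ rank (inj₁ i) ⊎ x ≡ rank (inj₂ i) →
        x ≡ rank (inj₁ j) ⊎ x ≡ rank (inj₂ j) → i ≡ j
      rank-unique {i} {j} (inj₁ u) (inj₁ v) = rank-injective (inj₁ i) (inj₁ j) (trans (sym u) v)
      rank-unique {i} {j} (inj₁ u) (inj₂ v) = rank-injective (inj₁ i) (inj₂ j) (trans (sym u) v)
      rank-unique {i} {j} (inj₂ u) (inj₁ v) = rank-injective (inj₂ i) (inj₁ j) (trans (sym u) v)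
      rank-unique {i} {j} (inj₂ u) (inj₂ v) = rank-injective (inj₂ i) (inj₂ j) (trans (sym u) v)

    diagram : ChordDiagram n (suc (n + n))
    diagram = record
      { l   = rank ∘ inj₁
      ; r   = rank ∘ inj₂
      ; l<r = λ i → rank-< {inj₁ i} {inj₂ i} (left<right (interval i))
      ; r<N = λ i → s≤s (∣p∣≤n (below (inj₂ i)))
      ; ends-unique = rank-unique
      }

    open ChordDiagram diagram

    private
      I : Fin n → Interval
      I = interval

      Overlap-sym : ∀ {i j} → Overlap (I i) (I j) → Overlap (I j) (I i)
      Overlap-sym {i} {j} = adj-sym (overlapGraph 𝓘) {i} {j}

      ⇝⇒Overlap : ∀ {i j} → i ⇝ j → Overlap (I i) (I j)
      ⇝⇒Overlap {i} {j} (u , v , w) =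
        let li<lj = rank-reflects (inj₁ i) (inj₁ j) i≢j u
            lj<ri = rank-reflects (inj₁ j) (inj₂ i) (i≢j ∘ sym) v
            ri<rj = rank-reflects (inj₂ i) (inj₂ j) i≢j w
            -- `x` will be a common point, `y` a point of `I i` outside `I j`, and `z` a point of
            -- `I j` outside `I i`.
            x , lj<x , x<ri = <ᴿ-dense {left (I j)} {right (I i)} lj<ri
            y , li<y , y<lj = <ᴿ-dense {left (I i)} {left (I j)} li<lj
            z , ri<z , z<rj = <ᴿ-dense {right (I i)} {right (I j)} ri<rj
        in ( x
           , (<ᴿ-trans {left (I i)} {left (I j)} {x} li<lj lj<x , x<ri)
           , (lj<x , <ᴿ-trans {x} {right (I i)} {right (I j)} x<ri ri<rj))
         , (λ I⊆J → <ᴿ-irrefl {y} (<ᴿ-trans {y} {left (I j)} {y} y<lj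
             (proj₁ (I⊆J {y} (li<y , <ᴿ-trans {y} {left (I j)} {right (I i)} y<lj lj<ri)))))
         , (λ J⊆I → <ᴿ-irrefl {z} (<ᴿ-trans {z} {right (I i)} {z}
             (proj₂ (J⊆I {z} (<ᴿ-trans {left (I j)} {right (I i)} {z} lj<ri ri<z , z<rj))) ri<z))
        where
        i≢j : i ≢ j
        i≢j refl = <-irrefl refl u

      -- A common point puts `left (I j)` below `right (I i)`. Were the right ends in the opposite
      -- order, `I j` would be contained in `I i`.
      Overlap⇒⇝ : ∀ {i j} → i ≢ j → left (I i) <ᴿ left (I j) → Overlap (I i) (I j) → i ⇝ j
      Overlap⇒⇝ {i} {j} i≢j li<lj ((x , (_ , x<ri) , (lj<x , _)) , _ , J⊈I) =
        rank-< {inj₁ i} {inj₁ j} li<lj , rank-< {inj₁ j} {inj₂ i} lj<ri , rank-< {inj₂ i} {inj₂ j} ri<rj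
        where
        lj<ri : left (I j) <ᴿ right (I i)
        lj<ri = <ᴿ-trans {left (I j)} {x} {right (I i)} lj<x x<ri
        ri<rj : right (I i) <ᴿ right (I j)
        ri<rj with separated (inj₂ i) (inj₂ j) i≢j
        ... | inj₁ lt = lt
        ... | inj₂ gt = ⊥-elim (J⊈I λ {y} (lj<y , y<rj) →
                <ᴿ-trans {left (I i)} {left (I j)} {y} li<lj lj<y ,
                <ᴿ-trans {y} {right (I j)} {right (I i)} y<rj gt)

    Cross⇒Overlap : ∀ {i j} → Cross i j → Overlap (I i) (I j)
    Cross⇒Overlap         (inj₁ x) = ⇝⇒Overlap x
    Cross⇒Overlap {i} {j} (inj₂ x) = Overlap-sym {j} {i} (⇝⇒Overlap x)

    Overlap⇒Cross : ∀ {i j} → Overlap (I i) (I j) → Cross i j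
    Overlap⇒Cross {i} {j} o = [ (λ lt → inj₁ (Overlap⇒⇝ i≢j lt o))
                              , (λ gt → inj₂ (Overlap⇒⇝ (i≢j ∘ sym) gt (Overlap-sym {i} {j} o)))
                              ]′ (separated (inj₁ i) (inj₁ j) i≢j)
      where
      i≢j : i ≢ j
      i≢j i≡j = adj-irrefl (overlapGraph 𝓘) i≡j o

-- Cliques as lists, and transfer of the colouring to the graph.

module _ {ℓ} (G : Graph ℓ) where

  toSubset : List (Vertex G) → Subset (order G)
  toSubset = List.foldr (λ v S → ⁅ v ⁆ ∪ S) ∅

  ∈-toSubset : ∀ vs {v} → v ∈ˢ toSubset vs → v ∈ vs
  ∈-toSubset []       v∈ = contradiction v∈ ∉⊥
  ∈-toSubset (u ∷ vs) v∈ = [ here ∘ x∈⁅y⁆⇒x≡y u , there ∘ ∈-toSubset vs ]′ (x∈p∪q⁻ ⁅ u ⁆ (toSubset vs) v∈)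

  -- Irreflexivity of adjacency excludes repetitions, so each list entry enlarges the subset.
  length≤∣toSubset∣ : ∀ {vs} → AllPairs (Adj G) vs → length vs ≤ ∣ toSubset vs ∣
  length≤∣toSubset∣ []                        = z≤n
  length≤∣toSubset∣ {v ∷ vs} (v~vs ∷ adj) = ≤-<-trans (length≤∣toSubset∣ adj) (p⊂q⇒∣p∣<∣q∣
    ( q⊆p∪q ⁅ v ⁆ (toSubset vs)
    , v
    , x∈p∪q⁺ (inj₁ (x∈⁅x⁆ v))
    , λ v∈ → adj-irrefl G refl (All.lookup v~vs (∈-toSubset vs v∈))))

  toSubset-clique : ∀ {vs} → AllPairs (Adj G) vs → IsClique G (toSubset vs)
  toSubset-clique {vs} adj u∈ v∈ = pair adj (∈-toSubset vs u∈) (∈-toSubset vs v∈)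
    where
    pair : ∀ {us} → AllPairs (Adj G) us → ∀ {u v} → u ∈ us → v ∈ us → u ≢ v → Adj G u v
    pair (_ ∷ _)    (here refl) (here refl) u≢v = contradiction refl u≢v
    pair (u~us ∷ _) (here refl) (there v∈)  _   = All.lookup u~us v∈
    pair (v~us ∷ _) (there u∈)  (here refl) _   = adj-sym G (All.lookup v~us u∈)
    pair (_ ∷ adj)  (there u∈)  (there v∈)  u≢v = pair adj u∈ v∈ u≢v

circle-colouring : ∀ {ℓ} (G : Graph ℓ) ((𝓘 , _) : IsCircleGraph G) ω →
  (∀ S → IsClique G S → ∣ S ∣ ≤ ω) → ¬ ¬ Colourable G (7 * ω * ω)
circle-colouring G (𝓘 , iso) ω clique≤ω = ¬¬-map colour (ends-comparable 𝓘)
  where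
  open _≅_ iso
  -- A single vertex is a clique. Without vertices ω may be 0, but then there is nothing to colour.
  1≤ω : Vertex G → 1 ≤ ω
  1≤ω v = subst (_≤ ω) (∣⁅x⁆∣≡1 v) (clique≤ω ⁅ v ⁆ λ u∈ w∈ u≢w →
    contradiction (trans (x∈⁅y⁆⇒x≡y v u∈) (sym (x∈⁅y⁆⇒x≡y v w∈))) u≢w)

  colour : _ → Colourable G (7 * ω * ω)
  colour lt? = (λ v → proj₁ (col (1≤ω v)) (to v)) , λ {u} {v} u~v eq →
    proj₂ (col (1≤ω u)) (Overlap⇒Cross 𝓘 lt? (Equivalence.to (preserves u v) u~v))
      -- The colours of `u` and `v` were obtained from two proofs of `1 ≤ ω`, which have to be
      -- identified first.
      (trans eq (cong (λ p → proj₁ (col p) (to v)) (≤-irrelevant (1≤ω v) (1≤ω u))))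
    where
    open ChordDiagram (diagram 𝓘 lt?)
    Cross⇒Adj : ∀ {i j} → Cross i j → Adj G (from i) (from j)
    Cross⇒Adj {i} {j} x = Equivalence.from (preserves (from i) (from j))
      (subst₂ (λ i j → Overlap (IntervalSystem.interval 𝓘 i) (IntervalSystem.interval 𝓘 j))
        (sym (Inverse.strictlyInverseˡ bijection i)) (sym (Inverse.strictlyInverseˡ bijection j))
        (Cross⇒Overlap 𝓘 lt? x))
    cross≤ω : ∀ is → AllPairs Cross is → length is ≤ ω
    cross≤ω is cr = begin
      length is                               ≡⟨ length-map from is ⟨
      length (List.map from is)               ≤⟨ length≤∣toSubset∣ G adj ⟩
      ∣ toSubset G (List.map from is) ∣       ≤⟨ clique≤ω _ (toSubset-clique G adj) ⟩
      ω                                       ∎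
      where
      open ≤-Reasoning
      adj : AllPairs (Adj G) (List.map from is)
      adj = AllPairs.map⁺ (AllPairs.map Cross⇒Adj cr)
    col : 1 ≤ ω → Σ (Fin _ → Fin (7 * ω * ω)) λ c → ∀ {i j} → Cross i j → c i ≢ c j
    col 1≤ω = colouring 1≤ω cross≤ω

theorem1 : ∀ {ℓ : Level} (G : Graph ℓ) → IsCircleGraph G →
    ∀ (ω χ : ℕ) → IsCliqueNumber G ω → IsChromaticNumber G χ →
    χ ≤ 7 * ω ^ 2
-- The inequality is decidable, hence stable under double negation, so colourability up to double
-- negation is enough.
theorem1 G circle ω χ (_ , clique≤ω) (_ , minimal) = decidable-stable (χ ≤? 7 * ω ^ 2)
  (¬¬-map (λ c → subst (χ ≤_) square (minimal (7 * ω * ω) c)) (circle-colouring G circle ω clique≤ω))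
  where
  square : 7 * ω * ω ≡ 7 * ω ^ 2
  square = trans (*-assoc 7 ω ω) (cong (λ z → 7 * (ω * z)) (sym (*-identityʳ ω)))
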